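{- Let $n\in\mathbb{N}$ and $\alpha\in\mathbb{Z}^n$. Let $s\in\mathbb{Z}$. Then, in the algebra $\operatorname{NSym}$, $$\mathfrak{S}_\alpha H_s=\sum_{\substack{\beta\in\mathbb{Z}^{n+1};\\ |\beta|=|\alpha|+s;\\ \alpha_i\le\beta_i\text{ for all }i\in[n];\\ 0\le\beta_{n+1}}}\mathfrak{S}_\beta.$$
   Context: $\mathbb{N}=\{0,1,2,\ldots\}$ and $[n]=\{1,2,\ldots,n\}$. For a tuple $\alpha\in\mathbb{Z}^m$, $\alpha_i$ is its $i$-th entry and $|\alpha|:=\alpha_1+\cdots+\alpha_m$. $S_m$ is the group of permutations of $[m]$, and $(-1)^\sigma$ is the sign of $\sigma$. Fix a commutative ring $\mathbf{k}$. $\operatorname{NSym}$ is the (free associative, unital) algebra of noncommutative polynomials in countably many variables $H_1,H_2,H_3,\ldots$ over $\mathbf{k}$. Set $H_0:=1$ and $H_k:=0$ for all $k<0$. For every $m\in\mathbb{N}$ and every $\alpha\in\mathbb{Z}^m$, set $H_\alpha:=H_{\alpha_1}H_{\alpha_2}\cdots H_{\alpha_m}\in\operatorname{NSym}$ and $$\mathfrak{S}_\alpha:=\sum_{\sigma\in S_m}(-1)^\sigma H_{(\alpha_1+\sigma(1)-1,\ \alpha_2+\sigma(2)-2,\ \ldots,\ \alpha_m+\sigma(m)-m)}\in\operatorname{NSym}.$$ -}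

module Defs where

open import Algebra.Bundles using (CommutativeRing; Semiring)
open import Data.Bool.Base using (if_then_else_)
open import Data.Fin.Base as Fin using (Fin; zero; toℕ)
import Data.Fin.Properties as Fin
open import Data.Fin.Permutation as Perm
  using (Permutation′; _⟨$⟩ʳ_; insert; remove; insert-remove)
open import Data.Integer.Base as ℤ using (ℤ; +_; -[1+_]; 0ℤ)
open import Data.List.Base as List
  using (List; []; _∷_; [_]; _++_; allFin; cartesianProduct; cartesianProductWith; filter; length)
import Data.List.Properties as List
open import Data.List.Membership.Propositional using (_∈_)
open import Data.List.Membership.Propositional.Properties using (∈-allFin)
open import Data.List.Relation.Unary.Any as Any using (Any)
open import Data.List.Relation.Unary.Any.Properties using (cartesianProductWith⁺)
open import Data.List.Relation.Unary.Unique.Propositional using (Unique)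
open import Data.Nat.Base as ℕ using (ℕ; zero; suc; _!)
import Data.Nat.Properties as ℕ
open import Data.Product.Base using (Σ-syntax; _×_; _,_)
open import Data.Vec.Base as Vec using (Vec; lookup; tabulate)
open import Function.Bundles using (_⇔_)
open import Level using (_⊔_)
open import Relation.Binary.PropositionalEquality
  using (_≡_; refl; trans; cong; cong₂)
open import Relation.Nullary.Decidable using (does; _×-dec_)
open import Relation.Unary using (Pred)

-- A permutation of Fin (suc m) is determined by the image j of zero and by
-- the permutation left over after removing zero and j.
permutations : ∀ m → List (Permutation′ m)
permutations zero    = [ Perm.id ]
permutations (suc m) =
  cartesianProductWith (insert zero) (allFin (suc m)) (permutations m)

-- Since S_m has m! elements, these two facts say that `permutations m` lists
-- each of them exactly once, up to pointwise equality.
permutations-complete : ∀ m (σ : Permutation′ m) → Any (Perm._≈ σ) (permutations m)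
permutations-complete zero    σ = Any.here λ ()
permutations-complete (suc m) σ =
  cartesianProductWith⁺ (insert zero) combine
    (∈-allFin (σ ⟨$⟩ʳ zero))
    (permutations-complete m (remove zero σ))
  where
  combine : ∀ {j τ} → σ ⟨$⟩ʳ zero ≡ j → τ Perm.≈ remove zero σ → insert zero j τ Perm.≈ σ
  combine refl τ≈ Fin.zero    = refl
  combine refl τ≈ (Fin.suc i) =
    trans (cong (Fin.punchIn (σ ⟨$⟩ʳ zero)) (τ≈ i)) (insert-remove zero σ (Fin.suc i))

length-permutations : ∀ m → length (permutations m) ≡ m !
length-permutations zero    = refl
length-permutations (suc m) =
  trans (length-product (insert zero) (allFin (suc m)) (permutations m))
        (cong₂ ℕ._*_ (List.length-tabulate {n = suc m} (λ i → i)) (length-permutations m))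
  where
  length-product : ∀ {A B C : Set} (f : A → B → C) xs ys →
                   length (cartesianProductWith f xs ys) ≡ length xs ℕ.* length ys
  length-product f []       ys = refl
  length-product f (x ∷ xs) ys =
    trans (List.length-++ (List.map (f x) ys))
          (cong₂ ℕ._+_ (List.length-map (f x) ys) (length-product f xs ys))

inversions : ∀ {m} → Permutation′ m → ℕ
inversions {m} σ =
  length (filter (λ (i , j) → (i Fin.<? j) ×-dec ((σ ⟨$⟩ʳ j) Fin.<? (σ ⟨$⟩ʳ i)))
                 (cartesianProduct (allFin m) (allFin m)))

size : ∀ {m} → Vec ℤ m → ℤ
size = Vec.foldr _ ℤ._+_ 0ℤ

module NSym {c ℓ} (𝐤 : CommutativeRing c ℓ) where

  private module 𝐤 = CommutativeRing 𝐤
  open import Algebra.Definitions.RawSemiring (Semiring.rawSemiring 𝐤.semiring) using (_^_)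

  infix  4 _≈_ _≈Σ[_]_
  infixl 6 _+_
  infixl 7 _*_
  infixr 7 _·_

  -- The letter i stands for the variable H_{i+1}.
  Word : Set
  Word = List ℕ

  -- A list of (coefficient , word) pairs represents the sum of its terms;
  -- words may repeat, and two lists represent the same noncommutative
  -- polynomial when all their coefficients agree (see _≈_).
  NSym : Set c
  NSym = List (𝐤.Carrier × Word)

  coeff : NSym → Word → 𝐤.Carrier
  coeff []            w = 𝐤.0#
  coeff ((a , u) ∷ f) w =
    (if does (List.≡-dec ℕ._≟_ u w) then a else 𝐤.0#) 𝐤.+ coeff f w

  _≈_ : NSym → NSym → Set ℓ
  f ≈ g = ∀ w → coeff f w 𝐤.≈ coeff g w

  0# : NSym
  0# = []

  1# : NSym
  1# = [ 𝐤.1# , [] ]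

  _+_ : NSym → NSym → NSym
  _+_ = _++_

  _*_ : NSym → NSym → NSym
  _*_ = cartesianProductWith λ (a , u) (b , v) → a 𝐤.* b , u ++ v

  _·_ : 𝐤.Carrier → NSym → NSym
  a · f = List.map (λ (b , u) → a 𝐤.* b , u) f

  sum : ∀ {i} {I : Set i} → List I → (I → NSym) → NSym
  sum is f = List.foldr (λ i g → f i + g) 0# is

  H : ℤ → NSym
  H (+ zero)  = 1#
  H (+ suc i) = [ 𝐤.1# , [ i ] ]
  H -[1+ _ ]  = 0#

  Hᵛ : ∀ {m} → Vec ℤ m → NSym
  Hᵛ = Vec.foldr _ (λ k f → H k * f) 1#

  sign : ∀ {m} → Permutation′ m → 𝐤.Carrier
  sign σ = (𝐤.- 𝐤.1#) ^ inversions σ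

  -- Positions are numbered from 0 rather than 1, which leaves the
  -- differences σ(i) − i unchanged.
  𝔖 : ∀ {m} → Vec ℤ m → NSym
  𝔖 {m} α = sum (permutations m) λ σ →
    sign σ · Hᵛ (tabulate λ i → lookup α i ℤ.+ + toℕ (σ ⟨$⟩ʳ i) ℤ.- + toℕ i)

  -- f ≈Σ[ P ] g : only finitely many x satisfy P, and f is the sum of the
  -- g x over all of them (each taken once).
  _≈Σ[_]_ : ∀ {i p} {I : Set i} → NSym → Pred I p → (I → NSym) → Set (i ⊔ p ⊔ ℓ)
  _≈Σ[_]_ {I = I} f P g =
    Σ[ xs ∈ List I ] Unique xs × (∀ x → x ∈ xs ⇔ P x) × f ≈ sum xs g

{-# OPTIONS --safe #-}

-- 𝔖 α is a determinant whose entry in row i and column j is H (αᵢ + j − i), the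
-- factors being multiplied in the order of the rows.  Put α_{n+1} = 0.  Summing
-- 𝔖 β X^(|β|−|α|) over all β ≽ α gives, row by row, the determinant of the matrix
-- B with entries B i j = Σ_k H (αᵢ + j − i + k) X^k.  Its columns satisfy
-- B j = A j + X B (j + 1) with A i j = H (αᵢ + j − i), so subtracting X times the
-- next column from each column but the last leaves the determinant unchanged and
-- turns the last row into (0, …, 0, Σ_k H k X^k).  Expanding along that row leaves
-- 𝔖 α Σ_k H k X^k.
--
-- The column operations need no antisymmetry: by induction, a minor of B
-- omitting column p equals that of A with columns p − 1 and p merged into
-- A (p − 1) + X A p, hence (by linearity in the merged column) a combination of
-- two minors of A, and the Laplace expansion of det B telescopes to that of det A.

module Submission where

open import Defs
open import Algebra.Bundles using (AbelianGroup; CommutativeRing; Semiring)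
import Algebra.Construct.Pointwise as Pointwise
import Algebra.Properties.AbelianGroup
import Algebra.Properties.CommutativeSemigroup
import Algebra.Properties.Ring
open import Data.Bool.Base using (Bool; true; false; if_then_else_; _∧_)
open import Data.Empty using (⊥; ⊥-elim)
open import Data.Fin.Base as Fin using (Fin; zero; suc; toℕ; inject₁; fromℕ; punchIn; punchOut)
open import Data.Fin.Permutation using (Permutation′; _⟨$⟩ʳ_; insert)
import Data.Fin.Properties as Fin
open import Data.Fin.Relation.Unary.Top using (view; view-fromℕ; view-inject₁; ‵fromℕ; ‵inject₁; ‵inj₁)
open import Data.Integer.Base as ℤ using (ℤ; +_; -[1+_]; 0ℤ; _≤_)
import Data.Integer.Properties as ℤ
open import Data.Integer.Tactic.RingSolver using (solve-∀)
open import Data.List.Base as List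
  using (List; []; _∷_; [_]; _++_; cartesianProduct; cartesianProductWith; filter; length; tabulate)
open import Data.List.Membership.Propositional using (_∈_)
open import Data.List.Membership.Propositional.Properties
  using (∈-++⁺ˡ; ∈-++⁺ʳ; ∈-++⁻; ∈-map⁺; ∈-map⁻)
import Data.List.Properties as List
import Data.List.Relation.Unary.All as All
open import Data.List.Relation.Unary.AllPairs using ([]; _∷_)
open import Data.List.Relation.Unary.Any using (here)
open import Data.List.Relation.Unary.Unique.Propositional using (Unique)
import Data.List.Relation.Unary.Unique.Propositional.Properties as Unique
open import Data.Nat.Base as ℕ using (ℕ; zero; suc)
import Data.Nat.Properties as ℕ
open import Data.Product.Base using (Σ-syntax; _×_; _,_; proj₂)
open import Data.Sum.Base using (inj₁; inj₂)
open import Data.Vec.Base as Vec using (Vec; []; _∷_; _∷ʳ_; lookup)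
import Data.Vec.Properties as Vec
open import Function.Base using (_∘_; id)
open import Function.Bundles using (mk⇔)
import Level
import Relation.Binary.Reasoning.Setoid
open import Relation.Binary.PropositionalEquality as ≡ using (_≡_; _≢_; cong; cong₂; subst)
open import Relation.Nullary.Decidable using (does; yes; no; _×-dec_)
open import Relation.Unary using (Pred; Decidable)
open import Algebra.Properties.CommutativeMonoid.Sum ℕ.+-0-commutativeMonoid
  using (sum-cong-≗; sum-permute) renaming (sum to Σ)

-- Inversions

⟦_⟧ : Bool → ℕ
⟦ b ⟧ = if b then 1 else 0

module _ {a b p} {A : Set a} {B : Set b} {P : Pred (A × B) p} (P? : Decidable P) where

  length-filter-row : ∀ {n} x (g : Fin n → B) (zs : List (A × B)) →
    length (filter P? (List.map (x ,_) (tabulate g) ++ zs)) ≡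
    Σ (λ j → ⟦ does (P? (x , g j)) ⟧) ℕ.+ length (filter P? zs)
  length-filter-row {zero}  x g zs = ≡.refl
  length-filter-row {suc n} x g zs with does (P? (x , g zero))
  ... | true  = cong suc (length-filter-row x (g ∘ suc) zs)
  ... | false = length-filter-row x (g ∘ suc) zs

  -- Turning a count over a filtered list into a sum over `Fin` makes it possible to reindex by a
  -- permutation.
  length-filter-product : ∀ {m n} (f : Fin m → A) (g : Fin n → B) →
    length (filter P? (cartesianProduct (tabulate f) (tabulate g))) ≡
    Σ (λ i → Σ λ j → ⟦ does (P? (f i , g j)) ⟧)
  length-filter-product {zero}  f g = ≡.refl
  length-filter-product {suc m} f g =
    ≡.trans (length-filter-row (f zero) g _) (cong (_ ℕ.+_) (length-filter-product (f ∘ suc) g))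

punchIn-<? : ∀ {m} (j : Fin (suc m)) a b →
             does (punchIn j a Fin.<? punchIn j b) ≡ does (a Fin.<? b)
punchIn-<? zero    a       b       = ≡.refl
punchIn-<? (suc j) zero    zero    = ≡.refl
punchIn-<? (suc j) zero    (suc b) = ≡.refl
punchIn-<? (suc j) (suc a) zero    = ≡.refl
punchIn-<? (suc j) (suc a) (suc b) = punchIn-<? j a b

count-below : ∀ {m} (j : Fin (suc m)) → Σ (λ k → ⟦ does (punchIn j k Fin.<? j) ⟧) ≡ toℕ j
count-below {zero}  zero    = ≡.refl
count-below {suc m} zero    = count-below {m} zero
count-below {suc m} (suc j) = cong suc (count-below j)

inversions-sum : ∀ {m} (σ : Permutation′ m) → inversions σ ≡
  Σ (λ i → Σ λ k → ⟦ does (i Fin.<? k) ∧ does ((σ ⟨$⟩ʳ k) Fin.<? (σ ⟨$⟩ʳ i)) ⟧)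
inversions-sum σ = length-filter-product
  (λ (i , k) → (i Fin.<? k) ×-dec ((σ ⟨$⟩ʳ k) Fin.<? (σ ⟨$⟩ʳ i))) id id

-- Position zero takes the value j and forms an inversion with each later position whose value lies
-- below j. Since τ only rearranges the values `punchIn j k`, there are `toℕ j` of these. All other
-- pairs keep their order because `punchIn j` is increasing. This yields the sign of the j-th term
-- in the expansion along the first row.
inversions-insert : ∀ {m} j (τ : Permutation′ m) →
                    inversions (insert zero j τ) ≡ toℕ j ℕ.+ inversions τ
inversions-insert {m} j τ = begin
  inversions (insert zero j τ)
    ≡⟨ inversions-sum (insert zero j τ) ⟩
  -- Row zero is split off by computation, and the pairs with second position zero drop out.
  Σ (λ k → ⟦ does (punchIn j (τ ⟨$⟩ʳ k) Fin.<? j) ⟧) ℕ.+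
    Σ (λ i → Σ λ k → ⟦ does (i Fin.<? k) ∧ does (punchIn j (τ ⟨$⟩ʳ k) Fin.<? punchIn j (τ ⟨$⟩ʳ i)) ⟧)
    ≡⟨ cong₂ ℕ._+_
         (≡.sym (sum-permute (λ k → ⟦ does (punchIn j k Fin.<? j) ⟧) τ))
         (sum-cong-≗ λ i → sum-cong-≗ λ k →
           cong (λ b → ⟦ does (i Fin.<? k) ∧ b ⟧) (punchIn-<? j (τ ⟨$⟩ʳ k) (τ ⟨$⟩ʳ i))) ⟩
  Σ (λ k → ⟦ does (punchIn j k Fin.<? j) ⟧) ℕ.+
    Σ (λ i → Σ λ k → ⟦ does (i Fin.<? k) ∧ does ((τ ⟨$⟩ʳ k) Fin.<? (τ ⟨$⟩ʳ i)) ⟧)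
    ≡⟨ cong₂ ℕ._+_ (count-below j)
         (≡.sym (inversions-sum τ)) ⟩
  toℕ j ℕ.+ inversions τ ∎
  where open ≡.≡-Reasoning

-- Determinants of matrices of operators

punchIn-fromℕ : ∀ {n} (j : Fin n) → punchIn (fromℕ n) j ≡ inject₁ j
punchIn-fromℕ zero    = ≡.refl
punchIn-fromℕ (suc j) = cong suc (punchIn-fromℕ j)

punchIn-inject₁ : ∀ {n} (p : Fin (suc n)) j → punchIn (inject₁ p) (inject₁ j) ≡ inject₁ (punchIn p j)
punchIn-inject₁ zero    j       = ≡.refl
punchIn-inject₁ (suc p) zero    = ≡.refl
punchIn-inject₁ (suc p) (suc j) = cong suc (punchIn-inject₁ p j)

punchIn-inject₁-fromℕ : ∀ {n} (p : Fin (suc n)) → punchIn (inject₁ p) (fromℕ n) ≡ fromℕ (suc n)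
punchIn-inject₁-fromℕ {n}     zero    = ≡.refl
punchIn-inject₁-fromℕ {suc n} (suc p) = cong suc (punchIn-inject₁-fromℕ p)

-- Additive maps and alternating sums in an abelian group

module AlternatingSums {c ℓ} (V : AbelianGroup c ℓ) where

  open AbelianGroup V public renaming
    ( Carrier to ∣V∣; _∙_ to infixl 6 _+_; ε to 0#; _⁻¹ to infix 8 -_
    ; ∙-cong to +-cong; ∙-congˡ to +-congˡ; ∙-congʳ to +-congʳ; ⁻¹-cong to -‿cong
    ; assoc to +-assoc; comm to +-comm; identityˡ to +-identityˡ; identityʳ to +-identityʳ
    ; inverseˡ to -‿inverseˡ; inverseʳ to -‿inverseʳ )
    hiding (_-_)
  open Algebra.Properties.AbelianGroup V public
    using (⁻¹-∙-comm; ε⁻¹≈ε; inverseˡ-unique; identityˡ-unique)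
  open Algebra.Properties.CommutativeSemigroup commutativeSemigroup public
    using (interchange; xy∙z≈xz∙y)
  open Relation.Binary.Reasoning.Setoid setoid public

  infixl 6 _-_
  _-_ : ∣V∣ → ∣V∣ → ∣V∣
  u - v = u + - v

  -‿congᵇ : ∀ {u u′ v v′} → u ≈ u′ → v ≈ v′ → u - v ≈ u′ - v′
  -‿congᵇ p q = +-cong p (-‿cong q)

  -‿interchange : ∀ u u′ v v′ → (u + u′) - (v + v′) ≈ (u - v) + (u′ - v′)
  -‿interchange u u′ v v′ =
    trans (+-congˡ (sym (⁻¹-∙-comm v v′))) (interchange u u′ (- v) (- v′))

  record Additive (f : ∣V∣ → ∣V∣) : Set (c Level.⊔ ℓ) where
    field
      ap-cong : ∀ {u v} → u ≈ v → f u ≈ f v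
      ap-+    : ∀ u v → f (u + v) ≈ f u + f v

    ap-0 : f 0# ≈ 0#
    ap-0 = identityˡ-unique _ _ (trans (sym (ap-+ 0# 0#)) (ap-cong (+-identityˡ 0#)))

    ap-neg : ∀ v → f (- v) ≈ - f v
    ap-neg v = inverseˡ-unique _ _
      (trans (sym (ap-+ (- v) v)) (trans (ap-cong (-‿inverseˡ v)) ap-0))

    ap-sub : ∀ u v → f (u - v) ≈ f u - f v
    ap-sub u v = trans (ap-+ u (- v)) (+-congˡ (ap-neg v))

  open Additive public

  -- The sum f 0 - f 1 + f 2 - ..., nested so that no powers of -1 are needed.
  alt : ∀ {m} → (Fin m → ∣V∣) → ∣V∣
  alt {zero}  f = 0#
  alt {suc m} f = f zero - alt (f ∘ suc)

  alt-cong : ∀ {m} {f g : Fin m → ∣V∣} → (∀ p → f p ≈ g p) → alt f ≈ alt g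
  alt-cong {zero}  f≈g = refl
  alt-cong {suc m} f≈g = -‿congᵇ (f≈g zero) (alt-cong (f≈g ∘ suc))

  alt-0 : ∀ {m} {f : Fin m → ∣V∣} → (∀ p → f p ≈ 0#) → alt f ≈ 0#
  alt-0 {zero}  f≈0 = refl
  alt-0 {suc m} f≈0 =
    trans (-‿congᵇ (f≈0 zero) (alt-0 (f≈0 ∘ suc))) (-‿inverseʳ 0#)

  alt-+ : ∀ {m} (f g : Fin m → ∣V∣) → alt (λ p → f p + g p) ≈ alt f + alt g
  alt-+ {zero}  f g = sym (+-identityˡ 0#)
  alt-+ {suc m} f g =
    trans (-‿congᵇ refl (alt-+ (f ∘ suc) (g ∘ suc))) (-‿interchange _ _ _ _)

  alt-additive : ∀ {h} → Additive h → ∀ {m} (f : Fin m → ∣V∣) → h (alt f) ≈ alt (h ∘ f)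
  alt-additive H {zero}  f = ap-0 H
  alt-additive H {suc m} f =
    trans (ap-sub H _ _) (-‿congᵇ refl (alt-additive H (f ∘ suc)))

  alt-init : ∀ {m} (f : Fin (suc m) → ∣V∣) → f (fromℕ m) ≈ 0# → alt f ≈ alt (f ∘ inject₁)
  alt-init {zero}  f last≈0 = trans (-‿congᵇ last≈0 refl) (-‿inverseʳ 0#)
  alt-init {suc m} f last≈0 = -‿congᵇ refl (alt-init (f ∘ suc) last≈0)

-- Operators commuting with X and determinants formed from them

module Determinants {c ℓ} (V : AbelianGroup c ℓ)
  (X : AbelianGroup.Carrier V → AbelianGroup.Carrier V)
  (X-additive : AlternatingSums.Additive V X)
  where

  open AlternatingSums V

  infixr 9 X^_

  X^_ : ℕ → ∣V∣ → ∣V∣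
  X^_ zero    v = v
  X^_ (suc e) v = X ((X^ e) v)

  X^-additive : ∀ e → Additive (X^ e)
  X^-additive zero    = record { ap-cong = λ p → p ; ap-+ = λ _ _ → refl }
  X^-additive (suc e) = record
    { ap-cong = ap-cong X-additive ∘ ap-cong (X^-additive e)
    ; ap-+    = λ u v → trans (ap-cong X-additive (ap-+ (X^-additive e) u v)) (ap-+ X-additive _ _)
    }

  X^-cong : ∀ e {u v} → u ≈ v → (X^ e) u ≈ (X^ e) v
  X^-cong e = ap-cong (X^-additive e)

  X^-+ : ∀ d e v → (X^ (d ℕ.+ e)) v ≈ (X^ d) ((X^ e) v)
  X^-+ zero    e v = refl
  X^-+ (suc d) e v = ap-cong X-additive (X^-+ d e v)

  -- Matrix entries commute with X but not necessarily with each other, as befits multiplication by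
  -- noncommutative polynomials over a central variable.
  record Op : Set (c Level.⊔ ℓ) where
    infixr 9 _⟪_⟫
    field
      _⟪_⟫     : ∣V∣ → ∣V∣
      additive : Additive _⟪_⟫
      commutes : ∀ v → _⟪_⟫ (X v) ≈ X (_⟪_⟫ v)

    X^-commutes : ∀ e v → _⟪_⟫ ((X^ e) v) ≈ (X^ e) (_⟪_⟫ v)
    X^-commutes zero    v = refl
    X^-commutes (suc e) v = trans (commutes _) (ap-cong X-additive (X^-commutes e v))

    op-cong : ∀ {u v} → u ≈ v → _⟪_⟫ u ≈ _⟪_⟫ v
    op-cong = ap-cong additive

  open Op public

  infix 4 _≗_
  _≗_ : Op → Op → Set (c Level.⊔ ℓ)
  f ≗ g = ∀ v → f ⟪ v ⟫ ≈ g ⟪ v ⟫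

  infix 4 _≗_+X^_·_
  _≗_+X^_·_ : Op → Op → ℕ → Op → Set (c Level.⊔ ℓ)
  f ≗ g +X^ e · h = ∀ v → f ⟪ v ⟫ ≈ g ⟪ v ⟫ + (X^ e) (h ⟪ v ⟫)

  add-X^ : Op → ℕ → Op → Op
  add-X^ g e h = record
    { _⟪_⟫     = λ v → g ⟪ v ⟫ + (X^ e) (h ⟪ v ⟫)
    ; additive = record
      { ap-cong = λ p → +-cong (op-cong g p) (X^-cong e (op-cong h p))
      ; ap-+    = λ u v → trans
          (+-cong (ap-+ (additive g) u v)
                  (trans (X^-cong e (ap-+ (additive h) u v)) (ap-+ (X^-additive e) _ _)))
          (interchange _ _ _ _)
      }
    ; commutes = λ v → trans
        (+-cong (commutes g v)
                (trans (X^-cong e (commutes h v)) (X-X^ e (h ⟪ v ⟫))))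
        (sym (ap-+ X-additive _ _))
    }
    where
    X-X^ : ∀ e v → (X^ e) (X v) ≈ X ((X^ e) v)
    X-X^ zero    v = refl
    X-X^ (suc e) v = ap-cong X-additive (X-X^ e v)

  Row : ℕ → Set (c Level.⊔ ℓ)
  Row k = Fin k → Op

  Matrix : ℕ → ℕ → Set (c Level.⊔ ℓ)
  Matrix m k = Fin m → Row k

  minor : ∀ {m k} → Matrix (suc m) (suc k) → Fin (suc k) → Matrix m k
  minor A p i j = A (suc i) (punchIn p j)

  -- The Laplace expansion along the first row, evaluated at a vector because
  -- the entries do not commute.
  det     : ∀ {m} → Matrix m m → ∣V∣ → ∣V∣
  laplace : ∀ {m} → Matrix (suc m) (suc m) → ∣V∣ → Fin (suc m) → ∣V∣

  det {zero}  A v = v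
  det {suc m} A v = alt (laplace A v)

  laplace A v p = A zero p ⟪ det (minor A p) v ⟫

  det-congˡ : ∀ {m} (A B : Matrix m m) → (∀ i j → A i j ≗ B i j) → ∀ v → det A v ≈ det B v
  det-congˡ {zero}  A B A≗B v = refl
  det-congˡ {suc m} A B A≗B v = alt-cong λ p → trans
    (op-cong (A zero p) (det-congˡ (minor A p) (minor B p) (λ i j → A≗B (suc i) (punchIn p j)) v))
    (A≗B zero p _)

  det-0 : ∀ {m} (A : Matrix m m) → det A 0# ≈ 0#
  det-0 {zero}  A = refl
  det-0 {suc m} A = alt-0 λ p →
    trans (op-cong (A zero p) (det-0 (minor A p))) (ap-0 (additive (A zero p)))

  -- Multilinearity in column q, formulated one row at a time; the three rows agree outside q.
  record LinearIn {k} (q : Fin k) (e : ℕ) (U W W′ : Row k) : Set (c Level.⊔ ℓ) where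
    field
      at   : U q ≗ W q +X^ e · W′ q
      offˡ : ∀ j → j ≢ q → U j ≗ W j
      offʳ : ∀ j → j ≢ q → U j ≗ W′ j

  open LinearIn

  -- In the expansion along the first row, the term omitting q has equal minors and an entry that
  -- splits. In every other term the entries agree, the minor splits by induction at `punchOut p≢q`,
  -- the new position of q, and the power of X moves out past the entry.
  det-linear : ∀ {m} q e {U W W′ : Matrix m m} → (∀ i → LinearIn q e (U i) (W i) (W′ i)) →
               ∀ v → det U v ≈ det W v + (X^ e) (det W′ v)
  det-linear {suc m} q e {U} {W} {W′} L v = begin
    det U v
      ≈⟨ alt-cong expand ⟩
    alt (λ p → laplace W v p + (X^ e) (laplace W′ v p))
      ≈⟨ alt-+ (laplace W v) ((X^ e) ∘ laplace W′ v) ⟩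
    det W v + alt ((X^ e) ∘ laplace W′ v)
      ≈⟨ +-congˡ (alt-additive (X^-additive e) (laplace W′ v)) ⟨
    det W v + (X^ e) (det W′ v) ∎
    where
    expand : ∀ p → laplace U v p ≈ laplace W v p + (X^ e) (laplace W′ v p)
    expand p with p Fin.≟ q
    ... | yes ≡.refl = trans (at (L zero) _)
      (+-cong (op-cong (W zero p) (det-congˡ (minor U p) (minor W p)
                 (λ i j → offˡ (L (suc i)) _ (Fin.punchInᵢ≢i p j)) v))
              (X^-cong e (op-cong (W′ zero p) (det-congˡ (minor U p) (minor W′ p)
                 (λ i j → offʳ (L (suc i)) _ (Fin.punchInᵢ≢i p j)) v))))
    ... | no p≢q = begin
      U zero p ⟪ det (minor U p) v ⟫
        ≈⟨ op-cong (U zero p) (det-linear (punchOut p≢q) e minor-linear v) ⟩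
      U zero p ⟪ det (minor W p) v + (X^ e) (det (minor W′ p) v) ⟫
        ≈⟨ ap-+ (additive (U zero p)) _ _ ⟩
      U zero p ⟪ det (minor W p) v ⟫ + U zero p ⟪ (X^ e) (det (minor W′ p) v) ⟫
        ≈⟨ +-cong (offˡ (L zero) p p≢q _)
             (trans (X^-commutes (U zero p) e _) (X^-cong e (offʳ (L zero) p p≢q _))) ⟩
      W zero p ⟪ det (minor W p) v ⟫ + (X^ e) (W′ zero p ⟪ det (minor W′ p) v ⟫) ∎
      where
      off : ∀ {j} → j ≢ punchOut p≢q → punchIn p j ≢ q
      off j≢ eq = j≢ (Fin.punchIn-injective p _ _ (≡.trans eq (≡.sym (Fin.punchIn-punchOut p≢q))))

      minor-linear : ∀ i → LinearIn (punchOut p≢q) e (minor U p i) (minor W p i) (minor W′ p i)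
      minor-linear i .at rewrite Fin.punchIn-punchOut p≢q = at (L (suc i))
      minor-linear i .offˡ j j≢ = offˡ (L (suc i)) _ (off j≢)
      minor-linear i .offʳ j j≢ = offʳ (L (suc i)) _ (off j≢)

  -- Unrolled, B j is the sum over l ≥ j of A l times X to the power e j + ... + e (l - 1). The
  -- exponents are left arbitrary because omitting a column of B fuses two consecutive steps and
  -- adds their exponents.
  record Suffix {k} (e : Fin k → ℕ) (A B : Row (suc k)) : Set (c Level.⊔ ℓ) where
    field
      step : ∀ j → B (inject₁ j) ≗ A (inject₁ j) +X^ e j · B (suc j)
      final : B (fromℕ k) ≗ A (fromℕ k)

  open Suffix

  Suffix-tail : ∀ {k} {e : Fin (suc k) → ℕ} {A B : Row (suc (suc k))} →
                Suffix e A B → Suffix (e ∘ suc) (A ∘ suc) (B ∘ suc)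
  Suffix-tail S .step = step S ∘ suc
  Suffix-tail S .final = final S

  -- The steps from column p - 1 to p and from p to p + 1 become one. If p is the first or the last
  -- column, the only step at p disappears.
  mergeᵉ : ∀ {k} → Fin (suc (suc k)) → (Fin (suc k) → ℕ) → Fin k → ℕ
  mergeᵉ zero          e         = e ∘ suc
  mergeᵉ (suc zero)    e zero    = e zero ℕ.+ e (suc zero)
  mergeᵉ (suc zero)    e (suc j) = e (suc (suc j))
  mergeᵉ (suc (suc p)) e zero    = e zero
  mergeᵉ (suc (suc p)) e (suc j) = mergeᵉ (suc p) (e ∘ suc) j

  -- Chosen so that B without column p consists of suffix sums again: column p of A, with its power
  -- of X, is absorbed into column p - 1, or dropped if p is zero.
  merge : ∀ {k} → Fin (suc k) → (Fin k → ℕ) → Row (suc k) → Row k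
  merge zero          e A         = A ∘ suc
  merge (suc zero)    e A zero    = add-X^ (A zero) (e zero) (A (suc zero))
  merge (suc zero)    e A (suc j) = A (suc (suc j))
  merge (suc (suc p)) e A zero    = A zero
  merge (suc (suc p)) e A (suc j) = merge (suc p) (e ∘ suc) (A ∘ suc) j

  -- Substituting the relation for B p into the one for B (p - 1) eliminates B p.
  merge-suffix : ∀ {k} (p : Fin (suc (suc k))) {e A B} → Suffix e A B →
                 Suffix (mergeᵉ p e) (merge p e A) (B ∘ punchIn p)
  merge-suffix zero S = Suffix-tail S
  -- Here the omitted column is the last one, so its relation is `final` and no further step
  -- follows.
  merge-suffix {zero} (suc zero) {e} S .final v =
    trans (step S zero v) (+-congˡ (X^-cong (e zero) (final S v)))
  merge-suffix {suc k} (suc zero) {e} {A} {B} S .step zero v = begin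
    B zero ⟪ v ⟫
      ≈⟨ step S zero v ⟩
    A zero ⟪ v ⟫ + (X^ e zero) (B (suc zero) ⟪ v ⟫)
      ≈⟨ +-congˡ (trans (X^-cong (e zero) (step S (suc zero) v)) (ap-+ (X^-additive (e zero)) _ _)) ⟩
    A zero ⟪ v ⟫ + ((X^ e zero) (A (suc zero) ⟪ v ⟫) +
      (X^ e zero) ((X^ e (suc zero)) (B (suc (suc zero)) ⟪ v ⟫)))
      ≈⟨ +-congˡ (+-congˡ (X^-+ (e zero) (e (suc zero)) _)) ⟨
    A zero ⟪ v ⟫ + ((X^ e zero) (A (suc zero) ⟪ v ⟫) +
      (X^ (e zero ℕ.+ e (suc zero))) (B (suc (suc zero)) ⟪ v ⟫))
      ≈⟨ +-assoc _ _ _ ⟨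
    (A zero ⟪ v ⟫ + (X^ e zero) (A (suc zero) ⟪ v ⟫)) +
      (X^ (e zero ℕ.+ e (suc zero))) (B (suc (suc zero)) ⟪ v ⟫) ∎
  merge-suffix {suc k} (suc zero) S .step (suc j) = step S (suc (suc j))
  merge-suffix {suc k} (suc zero) S .final         = final S
  merge-suffix {suc k} (suc (suc p)) S .step zero    = step S zero
  merge-suffix {suc k} (suc (suc p)) S .step (suc j) =
    merge-suffix (suc p) (Suffix-tail S) .step j
  merge-suffix {suc k} (suc (suc p)) S .final =
    merge-suffix (suc p) (Suffix-tail S) .final

  -- Omitting column p + 1 or column p of A gives two rows that differ only at position p, where
  -- they hold columns p and p + 1 respectively. Their combination there is the merged column.
  merge-linear : ∀ {k} (p : Fin k) (e : Fin k → ℕ) (A : Row (suc k)) →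
    LinearIn p (e p) (merge (suc p) e A) (A ∘ punchIn (suc p)) (A ∘ punchIn (inject₁ p))
  merge-linear zero e A .at v = refl
  merge-linear zero e A .offˡ zero    0≢0 = ⊥-elim (0≢0 ≡.refl)
  merge-linear zero e A .offˡ (suc j) _ v = refl
  merge-linear zero e A .offʳ zero    0≢0 = ⊥-elim (0≢0 ≡.refl)
  merge-linear zero e A .offʳ (suc j) _ v = refl
  merge-linear (suc p) e A .at = merge-linear p (e ∘ suc) (A ∘ suc) .at
  merge-linear (suc p) e A .offˡ zero    _ v = refl
  merge-linear (suc p) e A .offˡ (suc j) j≢p =
    merge-linear p (e ∘ suc) (A ∘ suc) .offˡ j (j≢p ∘ cong suc)
  merge-linear (suc p) e A .offʳ zero    _ v = refl
  merge-linear (suc p) e A .offʳ (suc j) j≢p =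
    merge-linear p (e ∘ suc) (A ∘ suc) .offʳ j (j≢p ∘ cong suc)

  -- Expanding `b p` and `N p` produces the term X^(e p) b (p + 1) M p once at p and once at p + 1,
  -- with opposite signs. The surplus t stands for what the preceding column passes on, so that the
  -- induction goes through.
  telescope : ∀ {k} {e : Fin k → ℕ} {a b : Row (suc k)} → Suffix e a b →
    ∀ (M N : Fin (suc k) → ∣V∣) t → N zero ≈ M zero + t →
    (∀ p → N (suc p) ≈ M (suc p) + (X^ e p) (M (inject₁ p))) →
    alt (λ p → b p ⟪ N p ⟫) ≈ alt (λ p → a p ⟪ M p ⟫) + b zero ⟪ t ⟫
  telescope {zero} {e} {a} {b} S M N t N₀ N₊ = begin
    b zero ⟪ N zero ⟫ - 0#
      ≈⟨ +-congʳ (op-cong (b zero) N₀) ⟩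
    b zero ⟪ M zero + t ⟫ - 0#
      ≈⟨ -‿congᵇ (ap-+ (additive (b zero)) _ _) (sym (+-identityˡ 0#)) ⟩
    (b zero ⟪ M zero ⟫ + b zero ⟪ t ⟫) - (0# + 0#)
      ≈⟨ -‿interchange _ _ _ _ ⟩
    (b zero ⟪ M zero ⟫ - 0#) + (b zero ⟪ t ⟫ - 0#)
      ≈⟨ +-cong (+-congʳ (final S _)) (trans (+-congˡ ε⁻¹≈ε) (+-identityʳ _)) ⟩
    (a zero ⟪ M zero ⟫ - 0#) + b zero ⟪ t ⟫ ∎
  telescope {suc k} {e} {a} {b} S M N t N₀ N₊ = begin
    b zero ⟪ N zero ⟫ - alt (λ p → b (suc p) ⟪ N (suc p) ⟫)
      ≈⟨ -‿congᵇ head tail ⟩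
    (a zero ⟪ M zero ⟫ + b zero ⟪ t ⟫ + x) - (T + x)
      ≈⟨ -‿interchange _ _ _ _ ⟩
    ((a zero ⟪ M zero ⟫ + b zero ⟪ t ⟫) - T) + (x - x)
      ≈⟨ trans (+-congˡ (-‿inverseʳ x)) (+-identityʳ _) ⟩
    (a zero ⟪ M zero ⟫ + b zero ⟪ t ⟫) - T
      ≈⟨ xy∙z≈xz∙y _ _ _ ⟩
    (a zero ⟪ M zero ⟫ - T) + b zero ⟪ t ⟫ ∎
    where
    x T : ∣V∣
    -- This cross term arises in column zero and, as the surplus of the tail, in column one; the two
    -- copies cancel.
    x = (X^ e zero) (b (suc zero) ⟪ M zero ⟫)
    T = alt (λ p → a (suc p) ⟪ M (suc p) ⟫)

    head : b zero ⟪ N zero ⟫ ≈ a zero ⟪ M zero ⟫ + b zero ⟪ t ⟫ + x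
    head = begin
      b zero ⟪ N zero ⟫                      ≈⟨ op-cong (b zero) N₀ ⟩
      b zero ⟪ M zero + t ⟫                  ≈⟨ ap-+ (additive (b zero)) _ _ ⟩
      b zero ⟪ M zero ⟫ + b zero ⟪ t ⟫       ≈⟨ +-congʳ (step S zero _) ⟩
      (a zero ⟪ M zero ⟫ + x) + b zero ⟪ t ⟫ ≈⟨ xy∙z≈xz∙y _ _ _ ⟩
      a zero ⟪ M zero ⟫ + b zero ⟪ t ⟫ + x   ∎

    tail : alt (λ p → b (suc p) ⟪ N (suc p) ⟫) ≈ T + x
    tail = trans
      (telescope (Suffix-tail S) (M ∘ suc) (N ∘ suc) ((X^ e zero) (M zero)) (N₊ zero) (N₊ ∘ suc))
      (+-congˡ (X^-commutes (b (suc zero)) (e zero) (M zero)))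

  -- Induction turns each minor of B into a merged minor of A, which `det-linear` splits into two
  -- minors of A with neighbouring omitted columns. These are the relations that `telescope` takes.
  det-suffix : ∀ {k} (e : Fin k → ℕ) {A B : Matrix (suc k) (suc k)} →
               (∀ i → Suffix e (A i) (B i)) → ∀ v → det B v ≈ det A v
  det-suffix {k} e {A} {B} S v = begin
    alt (λ p → B zero p ⟪ det (minor B p) v ⟫)
      ≈⟨ alt-cong (λ p → op-cong (B zero p) (minor-suffix k p e S)) ⟩
    alt (λ p → B zero p ⟪ det (λ i → merge p e (A (suc i))) v ⟫)
      -- Column zero has no left neighbour and `merge zero` merely drops it, so the initial surplus
      -- is `0#`.
      ≈⟨ telescope (S zero) (λ p → det (minor A p) v)
           (λ p → det (λ i → merge p e (A (suc i))) v) 0# (sym (+-identityʳ _))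
           (λ p → det-linear p (e p) (λ i → merge-linear p e (A (suc i))) v) ⟩
    det A v + B zero zero ⟪ 0# ⟫
      ≈⟨ trans (+-congˡ (ap-0 (additive (B zero zero)))) (+-identityʳ _) ⟩
    det A v ∎
    where
    minor-suffix : ∀ k p (e : Fin k → ℕ) {A B : Matrix (suc k) (suc k)} →
      (∀ i → Suffix e (A i) (B i)) → det (minor B p) v ≈ det (λ i → merge p e (A (suc i))) v
    minor-suffix zero    p e S = refl
    minor-suffix (suc k) p e S = det-suffix (mergeᵉ p e) (λ i → merge-suffix p (S (suc i))) v

  -- The expansion runs along the first row, so the shape of the last row is carried through the
  -- minors by induction. The operator of the last row acts first, on v itself; its result h becomes
  -- the vector on which the remaining rows act.
  det-last-row : ∀ {n} (A : Matrix (suc n) (suc n)) v h →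
    (∀ j w → A (fromℕ n) (inject₁ j) ⟪ w ⟫ ≈ 0#) → A (fromℕ n) (fromℕ n) ⟪ v ⟫ ≈ h →
    det A v ≈ det (λ i j → A (inject₁ i) (inject₁ j)) h
  det-last-row {zero}  A v h zeros last = trans (+-cong last ε⁻¹≈ε) (+-identityʳ h)
  det-last-row {suc n} A v h zeros last = trans
    (alt-init (laplace A v) (trans (op-cong (A zero _) last-minor) (ap-0 (additive (A zero _)))))
    (alt-cong λ p → op-cong (A zero (inject₁ p)) (inner-minor p))
    where
    -- Omitting the last column leaves a last row of zeros, so the induction hypothesis applies with
    -- h equal to `0#`.
    last-minor : det (minor A (fromℕ (suc n))) v ≈ 0#
    last-minor = trans
      (det-last-row (minor A (fromℕ (suc n))) v 0#
        (λ j w → subst (λ l → A (suc (fromℕ n)) l ⟪ w ⟫ ≈ 0#)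
          (≡.sym (punchIn-fromℕ (inject₁ j))) (zeros _ w))
        (subst (λ l → A (suc (fromℕ n)) l ⟪ v ⟫ ≈ 0#)
          (≡.sym (punchIn-fromℕ (fromℕ n))) (zeros (fromℕ n) v)))
      (det-0 (λ i j → minor A (fromℕ (suc n)) (inject₁ i) (inject₁ j)))

    inner-minor : ∀ p → det (minor A (inject₁ p)) v ≈
                        det (minor (λ i j → A (inject₁ i) (inject₁ j)) p) h
    inner-minor p = trans {j = det (λ i j → minor A (inject₁ p) (inject₁ i) (inject₁ j)) h}
      (det-last-row (minor A (inject₁ p)) v h
        (λ j w → subst (λ l → A (suc (fromℕ n)) l ⟪ w ⟫ ≈ 0#)
          (≡.sym (punchIn-inject₁ p j)) (zeros _ w))
        (subst (λ l → A (suc (fromℕ n)) l ⟪ v ⟫ ≈ h) (≡.sym (punchIn-inject₁-fromℕ p)) last))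
      (det-congˡ _ _
        (λ i j w → reflexive (cong (λ l → A (suc (inject₁ i)) l ⟪ w ⟫) (punchIn-inject₁ p j))) h)

-- Sums over lists and iterated negation

module ListSums {c ℓ} (V : AbelianGroup c ℓ) where

  open AlternatingSums V

  ∑ : ∀ {i} {I : Set i} → List I → (I → ∣V∣) → ∣V∣
  ∑ is f = List.foldr (λ i v → f i + v) 0# is

  ∑-cong : ∀ {i} {I : Set i} (is : List I) {f g : I → ∣V∣} → (∀ i → f i ≈ g i) → ∑ is f ≈ ∑ is g
  ∑-cong []       f≈g = refl
  ∑-cong (i ∷ is) f≈g = +-cong (f≈g i) (∑-cong is f≈g)

  ∑-++ : ∀ {i} {I : Set i} (is js : List I) (f : I → ∣V∣) → ∑ (is ++ js) f ≈ ∑ is f + ∑ js f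
  ∑-++ []       js f = sym (+-identityˡ _)
  ∑-++ (i ∷ is) js f = trans (+-congˡ (∑-++ is js f)) (sym (+-assoc _ _ _))

  ∑-map : ∀ {i j} {I : Set i} {J : Set j} (g : I → J) (is : List I) (f : J → ∣V∣) →
          ∑ (List.map g is) f ≈ ∑ is (f ∘ g)
  ∑-map g []       f = refl
  ∑-map g (i ∷ is) f = +-congˡ (∑-map g is f)

  ∑-additive : ∀ {h} → Additive h → ∀ {i} {I : Set i} (is : List I) (f : I → ∣V∣) →
               h (∑ is f) ≈ ∑ is (h ∘ f)
  ∑-additive H []       f = ap-0 H
  ∑-additive H (i ∷ is) f = trans (ap-+ H _ _) (+-congˡ (∑-additive H is f))

  ∑-0 : ∀ {i} {I : Set i} (is : List I) → ∑ is (λ _ → 0#) ≈ 0#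
  ∑-0 []       = refl
  ∑-0 (i ∷ is) = trans (+-identityˡ _) (∑-0 is)

  ∑-+ : ∀ {i} {I : Set i} (is : List I) (f g : I → ∣V∣) → ∑ is (λ i → f i + g i) ≈ ∑ is f + ∑ is g
  ∑-+ []       f g = sym (+-identityˡ 0#)
  ∑-+ (i ∷ is) f g = trans (+-congˡ (∑-+ is f g)) (interchange _ _ _ _)

  ∑-swap : ∀ {i j} {I : Set i} {J : Set j} (is : List I) (js : List J) (f : I → J → ∣V∣) →
           ∑ is (λ i → ∑ js (f i)) ≈ ∑ js (λ j → ∑ is (λ i → f i j))
  ∑-swap []       js f = sym (∑-0 js)
  ∑-swap (i ∷ is) js f = trans (+-congˡ (∑-swap is js f)) (sym (∑-+ js _ _))

  -- Plays the role of (-1)^n, as an abelian group has no scalars.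
  signed : ℕ → ∣V∣ → ∣V∣
  signed zero    v = v
  signed (suc n) v = - signed n v

  signed-cong : ∀ n {u v} → u ≈ v → signed n u ≈ signed n v
  signed-cong zero    u≈v = u≈v
  signed-cong (suc n) u≈v = -‿cong (signed-cong n u≈v)

  signed-additive : ∀ n → Additive (signed n)
  signed-additive n = record { ap-cong = signed-cong n ; ap-+ = signed-+ n }
    where
    signed-+ : ∀ n u v → signed n (u + v) ≈ signed n u + signed n v
    signed-+ zero    u v = refl
    signed-+ (suc n) u v = trans (-‿cong (signed-+ n u v)) (sym (⁻¹-∙-comm _ _))

  signed-∘ : ∀ m n v → signed (m ℕ.+ n) v ≈ signed m (signed n v)
  signed-∘ zero    n v = refl
  signed-∘ (suc m) n v = -‿cong (signed-∘ m n v)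

  additive-signed : ∀ {h} → Additive h → ∀ n v → h (signed n v) ≈ signed n (h v)
  additive-signed H zero    v = refl
  additive-signed H (suc n) v = trans (ap-neg H _) (-‿cong (additive-signed H n v))

  -- The list has the shape of `permutations (suc m)`, grouped by the image of zero. The offset d
  -- counts the groups already passed, each of which contributes one more sign.
  ∑-product-alt : ∀ {i j k} {I : Set i} {J : Set j} {K : Set k} (h : I → J → K)
    {m} (g : Fin m → I) (js : List J) (f : K → ∣V∣) d (G : Fin m → ∣V∣) →
    (∀ p → ∑ js (f ∘ h (g p)) ≈ signed (d ℕ.+ toℕ p) (G p)) →
    ∑ (cartesianProductWith h (tabulate g) js) f ≈ signed d (alt G)
  ∑-product-alt h {zero}  g js f d G eq = sym (ap-0 (signed-additive d))
  ∑-product-alt h {suc m} g js f d G eq = begin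
    ∑ (List.map (h (g zero)) js ++ cartesianProductWith h (tabulate (g ∘ suc)) js) f
      ≈⟨ trans (∑-++ (List.map (h (g zero)) js) _ f) (+-congʳ (∑-map (h (g zero)) js f)) ⟩
    ∑ js (f ∘ h (g zero)) + ∑ (cartesianProductWith h (tabulate (g ∘ suc)) js) f
      ≈⟨ +-cong (trans (eq zero) (reflexive (cong (λ e → signed e (G zero)) (ℕ.+-identityʳ d))))
           (∑-product-alt h (g ∘ suc) js f (suc d) (G ∘ suc) λ p →
             trans (eq (suc p)) (reflexive (cong (λ e → signed e (G (suc p))) (ℕ.+-suc d (toℕ p))))) ⟩
    signed d (G zero) - signed d (alt (G ∘ suc))
      ≈⟨ ap-sub (signed-additive d) _ _ ⟨
    signed d (alt G) ∎

-- The Leibniz formula for operator determinants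

module Leibniz {c ℓ} (V : AbelianGroup c ℓ)
  (X : AbelianGroup.Carrier V → AbelianGroup.Carrier V)
  (X-additive : AlternatingSums.Additive V X)
  where

  open AlternatingSums V
  open ListSums V
  open Determinants V X X-additive

  chain : ∀ {m} → (Fin m → Op) → ∣V∣ → ∣V∣
  chain {zero}  f v = v
  chain {suc m} f v = f zero ⟪ chain (f ∘ suc) v ⟫

  -- The permutations sending zero to p are the `insert zero p τ`. By `inversions-insert` they carry
  -- the extra sign (-1)^p, and by induction they add up to the p-th term of the expansion.
  leibniz : ∀ {m} (A : Matrix m m) v →
    ∑ (permutations m) (λ σ → signed (inversions σ) (chain (λ i → A i (σ ⟨$⟩ʳ i)) v)) ≈ det A v
  leibniz {zero}  A v = +-identityʳ v
  leibniz {suc m} A v =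
    ∑-product-alt (insert zero) id (permutations m) _ 0 (laplace A v) expand
    where
    expand : ∀ p → ∑ (permutations m) (λ τ → signed (inversions (insert zero p τ))
                     (A zero p ⟪ chain (λ i → minor A p i (τ ⟨$⟩ʳ i)) v ⟫))
                   ≈ signed (toℕ p) (laplace A v p)
    expand p = begin
      ∑ (permutations m) (λ τ → signed (inversions (insert zero p τ)) (A zero p ⟪ term τ ⟫))
        ≈⟨ ∑-cong (permutations m) (λ τ → begin
             signed (inversions (insert zero p τ)) (A zero p ⟪ term τ ⟫)
               ≡⟨ cong (λ e → signed e (A zero p ⟪ term τ ⟫)) (inversions-insert p τ) ⟩
             signed (toℕ p ℕ.+ inversions τ) (A zero p ⟪ term τ ⟫)
               ≈⟨ signed-∘ (toℕ p) (inversions τ) _ ⟩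
             signed (toℕ p) (signed (inversions τ) (A zero p ⟪ term τ ⟫))
               ≈⟨ signed-cong (toℕ p) (additive-signed (additive (A zero p)) (inversions τ) (term τ)) ⟨
             signed (toℕ p) (A zero p ⟪ signed (inversions τ) (term τ) ⟫) ∎) ⟩
      ∑ (permutations m) (λ τ → signed (toℕ p) (A zero p ⟪ signed (inversions τ) (term τ) ⟫))
        ≈⟨ ∑-additive (signed-additive (toℕ p)) (permutations m) _ ⟨
      signed (toℕ p) (∑ (permutations m) (λ τ → A zero p ⟪ signed (inversions τ) (term τ) ⟫))
        ≈⟨ signed-cong (toℕ p) (∑-additive (additive (A zero p)) (permutations m) _) ⟨
      signed (toℕ p) (A zero p ⟪ ∑ (permutations m) (λ τ → signed (inversions τ) (term τ)) ⟫)
        ≈⟨ signed-cong (toℕ p) (op-cong (A zero p) (leibniz (minor A p) v)) ⟩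
      signed (toℕ p) (laplace A v p) ∎
      where
      term : Permutation′ m → ∣V∣
      term τ = chain (λ i → minor A p i (τ ⟨$⟩ʳ i)) v

-- Vectors dominating a given one

infix 4 _≼_
_≼_ : ∀ {m} → Vec ℤ m → Vec ℤ m → Set
γ ≼ β = ∀ i → lookup γ i ℤ.≤ lookup β i

-- The β ≽ γ of size γ + s: either β and γ have the same first entry, or β still
-- dominates γ after the first entry of γ is increased by one.
dominating : ℕ → ∀ {m} → Vec ℤ m → List (Vec ℤ m)
dominating zero    []      = [ [] ]
dominating (suc s) []      = []
dominating zero    (a ∷ γ) = List.map (a ∷_) (dominating zero γ)
dominating (suc s) (a ∷ γ) =
  List.map (a ∷_) (dominating (suc s) γ) ++ dominating s (ℤ.suc a ∷ γ)

dominating-sound : ∀ s {m} (γ : Vec ℤ m) {β} → β ∈ dominating s γ →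
                   size β ≡ size γ ℤ.+ + s × γ ≼ β
dominating-sound-∷ : ∀ s {m} a (γ : Vec ℤ m) {β} → β ∈ List.map (a ∷_) (dominating s γ) →
                     size β ≡ size (a ∷ γ) ℤ.+ + s × (a ∷ γ) ≼ β

dominating-sound-∷ s a γ β∈ with ∈-map⁻ (a ∷_) β∈
... | β′ , β′∈ , ≡.refl with dominating-sound s γ β′∈
... | size≡ , γ≼β′ =
  ≡.trans (cong (ℤ._+_ a) size≡) (≡.sym (ℤ.+-assoc a (size γ) (+ s))) ,
  λ { zero → ℤ.≤-refl ; (suc i) → γ≼β′ i }

dominating-sound zero    []      (here ≡.refl) = ≡.refl , λ ()
dominating-sound zero    (a ∷ γ) β∈ = dominating-sound-∷ zero a γ β∈
dominating-sound (suc s) (a ∷ γ) β∈ with ∈-++⁻ (List.map (a ∷_) (dominating (suc s) γ)) β∈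
... | inj₁ β∈ˡ = dominating-sound-∷ (suc s) a γ β∈ˡ
... | inj₂ β∈ʳ with dominating-sound s (ℤ.suc a ∷ γ) β∈ʳ
... | size≡ , γ≼β =
  ≡.trans size≡ (rearrange a (size γ) (+ s)) ,
  λ { zero → ℤ.≤-trans (ℤ.i≤suc[i] a) (γ≼β zero) ; (suc i) → γ≼β (suc i) }
  where
  rearrange : ∀ x y z → + 1 ℤ.+ x ℤ.+ y ℤ.+ z ≡ x ℤ.+ y ℤ.+ (+ 1 ℤ.+ z)
  rearrange = solve-∀

-- The second branch of `dominating` is taken k times to raise the first entry, then the first
-- branch keeps it.
dominating-∷ : ∀ k s {m} a (γ : Vec ℤ m) {β} → β ∈ dominating s γ →
               (a ℤ.+ + k ∷ β) ∈ dominating (k ℕ.+ s) (a ∷ γ)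
dominating-∷ zero zero    a γ β∈ rewrite ℤ.+-identityʳ a = ∈-map⁺ (a ∷_) β∈
dominating-∷ zero (suc s) a γ β∈ rewrite ℤ.+-identityʳ a = ∈-++⁺ˡ (∈-map⁺ (a ∷_) β∈)
dominating-∷ (suc k) s a γ {β} β∈ =
  ∈-++⁺ʳ _ (subst (λ b → (b ∷ β) ∈ dominating (k ℕ.+ s) (ℤ.suc a ∷ γ)) (rearrange a (+ k))
    (dominating-∷ k s (ℤ.suc a) γ β∈))
  where
  rearrange : ∀ x y → + 1 ℤ.+ x ℤ.+ y ≡ x ℤ.+ (+ 1 ℤ.+ y)
  rearrange = solve-∀

dominating-complete : ∀ {m} (γ β : Vec ℤ m) → γ ≼ β →
                      Σ[ s ∈ ℕ ] size β ≡ size γ ℤ.+ + s × β ∈ dominating s γ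
dominating-complete []      []      _   = 0 , ≡.refl , here ≡.refl
dominating-complete (a ∷ γ) (b ∷ β) γ≼β with dominating-complete γ β (γ≼β ∘ suc)
... | s , size≡ , β∈ =
  k ℕ.+ s ,
  ≡.trans (cong₂ ℤ._+_ b≡a+k size≡) (≡.trans (rearrange a (+ k) (size γ) (+ s))
    (cong (ℤ._+_ (size (a ∷ γ))) (≡.sym (ℤ.pos-+ k s)))) ,
  subst (λ c → (c ∷ β) ∈ dominating (k ℕ.+ s) (a ∷ γ)) (≡.sym b≡a+k) (dominating-∷ k s a γ β∈)
  where
  k : ℕ
  -- Equal to b - a, which is nonnegative by domination in the first entry.
  k = ℤ.∣ b ℤ.- a ∣

  cancel : ∀ x y → y ≡ x ℤ.+ (y ℤ.- x)
  cancel = solve-∀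

  b≡a+k : b ≡ a ℤ.+ + k
  b≡a+k = ≡.trans (cancel a b) (cong (ℤ._+_ a) (≡.sym (ℤ.0≤i⇒+∣i∣≡i (ℤ.i≤j⇒0≤j-i (γ≼β zero)))))

  rearrange : ∀ x y z w → x ℤ.+ y ℤ.+ (z ℤ.+ w) ≡ x ℤ.+ z ℤ.+ (y ℤ.+ w)
  rearrange = solve-∀

-- The two branches are disjoint: the first entry is a in one and at least a + 1 in the other.
dominating-unique : ∀ s {m} (γ : Vec ℤ m) → Unique (dominating s γ)
dominating-unique zero    []      = All.[] ∷ []
dominating-unique (suc s) []      = []
dominating-unique zero    (a ∷ γ) = Unique.map⁺ Vec.∷-injectiveʳ (dominating-unique zero γ)
dominating-unique (suc s) (a ∷ γ) = Unique.++⁺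
  (Unique.map⁺ Vec.∷-injectiveʳ (dominating-unique (suc s) γ))
  (dominating-unique s (ℤ.suc a ∷ γ))
  disjoint
  where
  disjoint : ∀ {β} → β ∈ List.map (a ∷_) (dominating (suc s) γ) × β ∈ dominating s (ℤ.suc a ∷ γ) → _
  disjoint (β∈ˡ , β∈ʳ) with ∈-map⁻ (a ∷_) β∈ˡ
  ... | _ , _ , ≡.refl = ℤ.<-irrefl ≡.refl
    (ℤ.suc[i]≤j⇒i<j (proj₂ (dominating-sound s (ℤ.suc a ∷ γ) β∈ʳ) zero))

-- Noncommutative symmetric functions

-- The subscript of H in row i and column p is the case q = i. Keeping q separate allows rows to be
-- removed without renumbering the others.
entry : ∀ {m} → Vec ℤ m → Fin m → ℕ → ℕ → ℤ
entry α i p q = lookup α i ℤ.+ + p ℤ.- + q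

entry-sucᵖ : ∀ {m} (α : Vec ℤ m) i p q → entry α i (suc p) q ≡ ℤ.suc (entry α i p q)
entry-sucᵖ α i p q = rearrange (lookup α i) (+ p) (+ q)
  where
  rearrange : ∀ x y z → x ℤ.+ (+ 1 ℤ.+ y) ℤ.- z ≡ + 1 ℤ.+ (x ℤ.+ y ℤ.- z)
  rearrange = solve-∀

entry-suc-head : ∀ {m} a (γ : Vec ℤ m) p q →
                 entry (ℤ.suc a ∷ γ) zero p q ≡ ℤ.suc (entry (a ∷ γ) zero p q)
entry-suc-head a γ p q = rearrange a (+ p) (+ q)
  where
  rearrange : ∀ x y z → + 1 ℤ.+ x ℤ.+ y ℤ.- z ≡ + 1 ℤ.+ (x ℤ.+ y ℤ.- z)
  rearrange = solve-∀

lookup-∷ʳ-fromℕ : ∀ {a} {A : Set a} {m} (xs : Vec A m) x → lookup (xs ∷ʳ x) (fromℕ m) ≡ x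
lookup-∷ʳ-fromℕ []       x = ≡.refl
lookup-∷ʳ-fromℕ (_ ∷ xs) x = lookup-∷ʳ-fromℕ xs x

lookup-∷ʳ-inject₁ : ∀ {a} {A : Set a} {m} (xs : Vec A m) x i →
                    lookup (xs ∷ʳ x) (inject₁ i) ≡ lookup xs i
lookup-∷ʳ-inject₁ (_ ∷ xs) x zero    = ≡.refl
lookup-∷ʳ-inject₁ (_ ∷ xs) x (suc i) = lookup-∷ʳ-inject₁ xs x i

size-∷ʳ-0 : ∀ {m} (α : Vec ℤ m) → size (α ∷ʳ 0ℤ) ≡ size α
size-∷ʳ-0 α = Vec.foldr-∷ʳ _ ℤ._+_ 0ℤ α

≼-∷ʳ⁻ : ∀ {m} (α : Vec ℤ m) a β → (α ∷ʳ a) ≼ β →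
        (∀ i → lookup α i ≤ lookup β (inject₁ i)) × a ≤ lookup β (fromℕ m)
≼-∷ʳ⁻ α a β ≼β =
  (λ i → subst (_≤ lookup β (inject₁ i)) (lookup-∷ʳ-inject₁ α a i) (≼β (inject₁ i))) ,
  subst (_≤ lookup β (fromℕ _)) (lookup-∷ʳ-fromℕ α a) (≼β (fromℕ _))

≼-∷ʳ⁺ : ∀ {m} (α : Vec ℤ m) a β → (∀ i → lookup α i ≤ lookup β (inject₁ i)) →
        a ≤ lookup β (fromℕ m) → (α ∷ʳ a) ≼ β
≼-∷ʳ⁺ α a β α≼ a≤ i with view i
... | ‵fromℕ     = subst (_≤ lookup β (fromℕ _)) (≡.sym (lookup-∷ʳ-fromℕ α a)) a≤
... | ‵inject₁ j = subst (_≤ lookup β (inject₁ j)) (≡.sym (lookup-∷ʳ-inject₁ α a j)) (α≼ j)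

-- Domination forces the integer s to be a natural number. This serves both signs of s: it places β
-- in the list, or shows that no β exists.
dominating-∷ʳ-complete : ∀ {m} (α : Vec ℤ m) β {s} → size β ≡ size α ℤ.+ s →
  (∀ i → lookup α i ≤ lookup β (inject₁ i)) → 0ℤ ≤ lookup β (fromℕ m) →
  Σ[ t ∈ ℕ ] s ≡ + t × β ∈ dominating t (α ∷ʳ 0ℤ)
dominating-∷ʳ-complete α β size≡ α≼β 0≤
  with dominating-complete (α ∷ʳ 0ℤ) β (≼-∷ʳ⁺ α 0ℤ β α≼β 0≤)
... | t , size≡′ , β∈ =
  t ,
  +-cancelˡ (size α) _ _
    (≡.trans (≡.sym size≡) (≡.trans size≡′ (cong (ℤ._+ + t) (size-∷ʳ-0 α)))) ,
  β∈
  where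
  open Algebra.Properties.AbelianGroup ℤ.+-0-abelianGroup
    using () renaming (∙-cancelˡ to +-cancelˡ)

-- The action of polynomials on coefficient functions

module Words {c ℓ} (𝐤 : CommutativeRing c ℓ) where

  open CommutativeRing 𝐤 hiding (zero)
  open Algebra.Properties.Ring ring using (-1*x≈-x; -‿distribˡ-*)
  open Algebra.Properties.CommutativeSemigroup
    (AbelianGroup.commutativeSemigroup +-abelianGroup) using (interchange)
  open Relation.Binary.Reasoning.Setoid setoid
  open NSym 𝐤 public
    using (Word; NSym; coeff; H; Hᵛ; 𝔖; sign)
    renaming (_*_ to _⊛_; _·_ to _⊙_; 1# to 1ᴺ; sum to Σᴺ)
  open ListSums +-abelianGroup using (∑; ∑-cong; signed)

  Coefficients : Set c
  Coefficients = Word → Carrier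

  infix 4 _≋_
  _≋_ : Coefficients → Coefficients → Set ℓ
  F ≋ G = ∀ w → F w ≈ G w

  -- The coefficients of the word u times the series F: the value at w is that of F at the rest of w
  -- after the prefix u, or zero if u is not a prefix.
  strip : Word → Coefficients → Coefficients
  strip []      F w       = F w
  strip (i ∷ u) F []      = 0#
  strip (i ∷ u) F (j ∷ w) = if does (i ℕ.≟ j) then strip u F w else 0#

  -- Left multiplication on coefficient functions: coeff (f ⊛ g) = act f (coeff g).
  act : NSym → Coefficients → Coefficients
  act []            F w = 0#
  act ((a , u) ∷ f) F w = a * strip u F w + act f F w

  strip-cong : ∀ u {F G} → F ≋ G → strip u F ≋ strip u G
  strip-cong []      F≋G w       = F≋G w
  strip-cong (i ∷ u) F≋G []      = refl
  strip-cong (i ∷ u) F≋G (j ∷ w) with does (i ℕ.≟ j)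
  ... | true  = strip-cong u F≋G w
  ... | false = refl

  strip-0 : ∀ u w → strip u (λ _ → 0#) w ≈ 0#
  strip-0 []      w       = refl
  strip-0 (i ∷ u) []      = refl
  strip-0 (i ∷ u) (j ∷ w) with does (i ℕ.≟ j)
  ... | true  = strip-0 u w
  ... | false = refl

  strip-+ : ∀ u F G w → strip u (λ w → F w + G w) w ≈ strip u F w + strip u G w
  strip-+ []      F G w       = refl
  strip-+ (i ∷ u) F G []      = sym (+-identityˡ 0#)
  strip-+ (i ∷ u) F G (j ∷ w) with does (i ℕ.≟ j)
  ... | true  = strip-+ u F G w
  ... | false = sym (+-identityˡ 0#)

  strip-* : ∀ u a F w → strip u (λ w → a * F w) w ≈ a * strip u F w
  strip-* []      a F w       = refl
  strip-* (i ∷ u) a F []      = sym (zeroʳ a)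
  strip-* (i ∷ u) a F (j ∷ w) with does (i ℕ.≟ j)
  ... | true  = strip-* u a F w
  ... | false = sym (zeroʳ a)

  strip-++ : ∀ u v F → strip (u ++ v) F ≋ strip u (strip v F)
  strip-++ []      v F w       = refl
  strip-++ (i ∷ u) v F []      = refl
  strip-++ (i ∷ u) v F (j ∷ w) with does (i ℕ.≟ j)
  ... | true  = strip-++ u v F w
  ... | false = refl

  act-cong : ∀ f {F G} → F ≋ G → act f F ≋ act f G
  act-cong []            F≋G w = refl
  act-cong ((a , u) ∷ f) F≋G w = +-cong (*-congˡ (strip-cong u F≋G w)) (act-cong f F≋G w)

  act-0 : ∀ f w → act f (λ _ → 0#) w ≈ 0#
  act-0 []            w = refl
  act-0 ((a , u) ∷ f) w =
    trans (+-cong (trans (*-congˡ (strip-0 u w)) (zeroʳ a)) (act-0 f w)) (+-identityˡ 0#)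

  act-+ : ∀ f F G w → act f (λ w → F w + G w) w ≈ act f F w + act f G w
  act-+ []            F G w = sym (+-identityˡ 0#)
  act-+ ((a , u) ∷ f) F G w = trans
    (+-cong (trans (*-congˡ (strip-+ u F G w)) (distribˡ a _ _)) (act-+ f F G w))
    (interchange _ _ _ _)

  act-∑ : ∀ f {i} {I : Set i} (is : List I) (F : I → Coefficients) w →
          act f (λ w → ∑ is (λ i → F i w)) w ≈ ∑ is (λ i → act f (F i) w)
  act-∑ f []       F w = act-0 f w
  act-∑ f (i ∷ is) F w = trans (act-+ f (F i) _ w) (+-congˡ (act-∑ f is F w))

  act-++ : ∀ f g F w → act (f ++ g) F w ≈ act f F w + act g F w
  act-++ []            g F w = sym (+-identityˡ _)
  act-++ ((a , u) ∷ f) g F w = trans (+-congˡ (act-++ f g F w)) (sym (+-assoc _ _ _))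

  act-map : ∀ a u g F w →
    act (List.map (λ (b , v) → a * b , u ++ v) g) F w ≈ a * strip u (act g F) w
  act-map a u []            F w = sym (trans (*-congˡ (strip-0 u w)) (zeroʳ a))
  act-map a u ((b , v) ∷ g) F w = begin
    a * b * strip (u ++ v) F w + act (List.map _ g) F w
      ≈⟨ +-cong (trans (*-congˡ (strip-++ u v F w)) (*-assoc a b _)) (act-map a u g F w) ⟩
    a * (b * strip u (strip v F) w) + a * strip u (act g F) w
      ≈⟨ distribˡ a _ _ ⟨
    a * (b * strip u (strip v F) w + strip u (act g F) w)
      ≈⟨ *-congˡ (+-congʳ (strip-* u b (strip v F) w)) ⟨
    a * (strip u (λ w → b * strip v F w) w + strip u (act g F) w)
      ≈⟨ *-congˡ (strip-+ u _ _ w) ⟨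
    a * strip u (act ((b , v) ∷ g) F) w ∎

  act-⊛ : ∀ f g F → act (f ⊛ g) F ≋ act f (act g F)
  act-⊛ []            g F w = refl
  act-⊛ ((a , u) ∷ f) g F w = trans (act-++ (List.map _ g) (f ⊛ g) F w)
    (+-cong (act-map a u g F w) (act-⊛ f g F w))

  -- The subscript is negative. It is written as an entry of the last row, left of the diagonal,
  -- with 0 as the appended part.
  H-vanishes : ∀ {i n F} → i ℕ.< n → act (H (+ 0 ℤ.+ + i ℤ.- + n)) F ≋ λ _ → 0#
  H-vanishes {i} {n} {F} i<n w = reflexive (cong (λ f → act f F w) (H≡0 (ℤ.m-n≡m⊖n i n) i<n))
    where
    H≡0 : ∀ {i n z} → z ≡ i ℤ.⊖ n → i ℕ.< n → H z ≡ []
    H≡0 {i} {n} ≡.refl i<n rewrite ℤ.⊖-< i<n with n ℕ.∸ i in eq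
    ... | zero  = ⊥-elim (ℕ.<⇒≱ i<n (ℕ.m∸n≡0⇒m≤n eq))
    ... | suc _ = ≡.refl

  δ : Coefficients
  δ = coeff 1ᴺ

  strip-δ : ∀ u w → strip u δ w ≈ (if does (List.≡-dec ℕ._≟_ u w) then 1# else 0#)
  strip-δ []      []      = +-identityʳ _
  strip-δ []      (j ∷ w) = +-identityʳ _
  strip-δ (i ∷ u) []      = refl
  strip-δ (i ∷ u) (j ∷ w) with does (i ℕ.≟ j)
  ... | true  = strip-δ u w
  ... | false = refl

  -- Every polynomial is its own product with 1, so statements about coefficients follow from
  -- statements about the action.
  coeff-act : ∀ f → coeff f ≋ act f δ
  coeff-act []            w = refl
  coeff-act ((a , u) ∷ f) w = +-cong (sym (trans (*-congˡ (strip-δ u w)) branch)) (coeff-act f w)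
    where
    branch : a * (if does (List.≡-dec ℕ._≟_ u w) then 1# else 0#)
             ≈ (if does (List.≡-dec ℕ._≟_ u w) then a else 0#)
    branch with does (List.≡-dec ℕ._≟_ u w)
    ... | true  = *-identityʳ a
    ... | false = zeroʳ a

  coeff-⊛ : ∀ f g → coeff (f ⊛ g) ≋ act f (coeff g)
  coeff-⊛ f g w = begin
    coeff (f ⊛ g) w     ≈⟨ coeff-act (f ⊛ g) w ⟩
    act (f ⊛ g) δ w     ≈⟨ act-⊛ f g δ w ⟩
    act f (act g δ) w   ≈⟨ act-cong f (coeff-act g) w ⟨
    act f (coeff g) w   ∎

  act-1 : ∀ F → act 1ᴺ F ≋ F
  act-1 F w = trans (+-identityʳ _) (*-identityˡ _)

  act-Σ : ∀ {i} {I : Set i} (is : List I) (f : I → NSym) F w →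
          act (Σᴺ is f) F w ≈ ∑ is (λ i → act (f i) F w)
  act-Σ []       f F w = refl
  act-Σ (i ∷ is) f F w = trans (act-++ (f i) _ F w) (+-congˡ (act-Σ is f F w))

  sign-signed : ∀ {m} (σ : Permutation′ m) x → sign σ * x ≈ signed (inversions σ) x
  sign-signed σ x = go (inversions σ)
    where
    open import Algebra.Definitions.RawSemiring (Semiring.rawSemiring semiring) using (_^_)
    go : ∀ n → ((- 1#) ^ n) * x ≈ signed n x
    go zero    = *-identityˡ x
    go (suc n) = trans (*-congʳ (-1*x≈-x _)) (trans (sym (-‿distribˡ-* _ x)) (-‿cong (go n)))

  term : ∀ {m} → Vec ℤ m → Permutation′ m → NSym
  term α σ = Hᵛ (Vec.tabulate λ i → entry α i (toℕ (σ ⟨$⟩ʳ i)) (toℕ i))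

  act-𝔖 : ∀ {m} (α : Vec ℤ m) F w →
    act (𝔖 α) F w ≈ ∑ (permutations m) (λ σ → signed (inversions σ) (act (term α σ) F w))
  act-𝔖 {m} α F w = trans (act-Σ (permutations m) (λ σ → sign σ ⊙ term α σ) F w)
    (∑-cong (permutations m) λ σ →
      -- Scaling is multiplication by a term whose word is empty.
      trans (act-map (sign σ) [] (term α σ) F w) (sign-signed σ _))

-- Generating series and the column operations

module Series {c ℓ} (𝐤 : CommutativeRing c ℓ) where

  open CommutativeRing 𝐤 hiding (zero)
  open Algebra.Properties.CommutativeSemigroup
    (AbelianGroup.commutativeSemigroup +-abelianGroup) using (interchange)
  open Words 𝐤
  open ListSums +-abelianGroup
    using (∑; ∑-cong; ∑-++; ∑-map; ∑-additive; ∑-swap; signed; signed-cong; signed-additive)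

  -- Power series in one central variable X whose coefficients are
  -- noncommutative formal power series.
  V : AbelianGroup c ℓ
  V = Pointwise.abelianGroup ℕ (Pointwise.abelianGroup Word +-abelianGroup)

  open AbelianGroup V using () renaming (Carrier to ∣V∣; _≈_ to _≈ⱽ_)

  X : ∣V∣ → ∣V∣
  X f zero    = λ _ → 0#
  X f (suc s) = f s

  X-additive : AlternatingSums.Additive V X
  X-additive = record
    { ap-cong = λ { f≈g zero w → refl ; f≈g (suc s) w → f≈g s w }
    ; ap-+    = λ { f g zero w → sym (+-identityˡ 0#) ; f g (suc s) w → refl }
    }

  open AlternatingSums V using (ap-cong; ap-+) public
  open Determinants V X X-additive public
  open Leibniz V X X-additive public

  const : ℤ → Op
  const b = record
    { _⟪_⟫     = λ f s → act (H b) (f s)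
    ; additive = record
      { ap-cong = λ f≈g s → act-cong (H b) (f≈g s)
      ; ap-+    = λ f g s → act-+ (H b) (f s) (g s)
      }
    ; commutes = λ { f zero w → act-0 (H b) w ; f (suc s) w → refl }
    }

  -- Multiplication by the series Σ_k H (b + k) X^k.
  geometric : ℤ → Op
  geometric b = record
    { _⟪_⟫     = conv b
    ; additive = record { ap-cong = conv-cong b ; ap-+ = conv-+ b }
    ; commutes = conv-X b
    }
    where
    conv : ℤ → ∣V∣ → ∣V∣
    conv b f zero    w = act (H b) (f zero) w
    conv b f (suc s) w = act (H b) (f (suc s)) w + conv (ℤ.suc b) f s w

    conv-cong : ∀ b {f g} → f ≈ⱽ g → conv b f ≈ⱽ conv b g
    conv-cong b f≈g zero    w = act-cong (H b) (f≈g zero) w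
    conv-cong b f≈g (suc s) w = +-cong (act-cong (H b) (f≈g (suc s)) w) (conv-cong _ f≈g s w)

    conv-+ : ∀ b f g → conv b (λ s w → f s w + g s w) ≈ⱽ (λ s w → conv b f s w + conv b g s w)
    conv-+ b f g zero    w = act-+ (H b) (f zero) (g zero) w
    conv-+ b f g (suc s) w = trans
      (+-cong (act-+ (H b) (f (suc s)) (g (suc s)) w) (conv-+ _ f g s w)) (interchange _ _ _ _)

    conv-X : ∀ b f → conv b (X f) ≈ⱽ X (conv b f)
    conv-X b f zero          w = act-0 (H b) w
    conv-X b f (suc zero)    w = trans (+-congˡ (conv-X (ℤ.suc b) f zero w)) (+-identityʳ _)
    conv-X b f (suc (suc s)) w = +-congˡ (conv-X _ f (suc s) w)

  geometric-step : ∀ b → geometric b ≗ const b +X^ 1 · geometric (ℤ.suc b)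
  geometric-step b f zero    w = sym (+-identityʳ _)
  geometric-step b f (suc s) w = refl

  δ⁰ : ∣V∣
  δ⁰ zero    = δ
  δ⁰ (suc _) = λ _ → 0#

  geometric-δ⁰ : ∀ b s w → (geometric b ⟪ δ⁰ ⟫) s w ≈ coeff (H (b ℤ.+ + s)) w
  geometric-δ⁰ b zero    w =
    trans (sym (coeff-act (H b) w)) (reflexive (cong (λ b → coeff (H b) w) (≡.sym (ℤ.+-identityʳ b))))
  geometric-δ⁰ b (suc s) w = trans (+-cong (act-0 (H b) w) (geometric-δ⁰ (ℤ.suc b) s w))
    (trans (+-identityˡ _) (reflexive (cong (λ b → coeff (H b) w)
      (≡.trans (cong (ℤ._+ + s) (ℤ.+-comm (+ 1) b)) (ℤ.+-assoc b (+ 1) (+ s))))))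

  ∑-at : ∀ {i} {I : Set i} (is : List I) (f : I → ∣V∣) s w →
         ListSums.∑ V is f s w ≡ ∑ is (λ i → f i s w)
  ∑-at []       f s w = ≡.refl
  ∑-at (i ∷ is) f s w = cong (λ x → f i s w + x) (∑-at is f s w)

  signed-at : ∀ n f s w → ListSums.signed V n f s w ≡ signed n (f s w)
  signed-at zero    f s w = ≡.refl
  signed-at (suc n) f s w = cong -_ (signed-at n f s w)

  det-at : ∀ {m} (A : Matrix m m) v s w →
    det A v s w ≈ ∑ (permutations m) (λ σ → signed (inversions σ) (chain (λ i → A i (σ ⟨$⟩ʳ i)) v s w))
  det-at {m} A v s w = trans (sym (leibniz A v s w))
    (trans (reflexive (∑-at (permutations m) _ s w))
      (∑-cong (permutations m) λ σ → reflexive (signed-at (inversions σ) _ s w)))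

  chain-const : ∀ {m} (b : Fin m → ℤ) v s w →
                chain (const ∘ b) v s w ≈ act (Hᵛ (Vec.tabulate b)) (v s) w
  chain-const {zero}  b v s w = sym (act-1 (v s) w)
  chain-const {suc m} b v s w = trans
    (act-cong (H (b zero)) (chain-const (b ∘ suc) v s) w)
    (sym (act-⊛ (H (b zero)) _ (v s) w))

  -- To reach degree s, the product of the series takes X^(k i) from row i with the k i adding up to
  -- s, which amounts to choosing β = γ + k. The recursions match: either the first entry stays, or
  -- it is raised by one and the remaining degree drops by one.
  chain-geometric : ∀ s {m} (γ : Vec ℤ m) (p q : Fin m → ℕ) w →
    ∑ (dominating s γ) (λ β → act (Hᵛ (Vec.tabulate λ i → entry β i (p i) (q i))) δ w)
    ≈ chain (λ i → geometric (entry γ i (p i) (q i))) δ⁰ s w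
  chain-geometric-∷ : ∀ s {m} a (γ : Vec ℤ m) (p q : Fin (suc m) → ℕ) w →
    ∑ (List.map (a ∷_) (dominating s γ)) (λ β → act (Hᵛ (Vec.tabulate λ i → entry β i (p i) (q i))) δ w)
    ≈ act (H (entry (a ∷ γ) zero (p zero) (q zero)))
        (chain (λ i → geometric (entry γ i (p (suc i)) (q (suc i)))) δ⁰ s) w

  chain-geometric zero    []      p q w = trans (+-identityʳ _) (act-1 δ w)
  chain-geometric (suc s) []      p q w = refl
  chain-geometric zero    (a ∷ γ) p q w = chain-geometric-∷ zero a γ p q w
  chain-geometric (suc s) (a ∷ γ) p q w = trans
    (∑-++ (List.map (a ∷_) (dominating (suc s) γ)) _ _)
    (+-cong (chain-geometric-∷ (suc s) a γ p q w)
      (trans (chain-geometric s (ℤ.suc a ∷ γ) p q w)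
        (reflexive (cong
          (λ b → (geometric b ⟪ chain (λ i → geometric (entry γ i (p (suc i)) (q (suc i)))) δ⁰ ⟫) s w)
          (entry-suc-head a γ (p zero) (q zero))))))

  chain-geometric-∷ s a γ p q w = trans
    (∑-map (a ∷_) (dominating s γ) _)
    (trans (∑-cong (dominating s γ) λ β → act-⊛ (H (entry (a ∷ γ) zero (p zero) (q zero))) _ δ w)
      (trans (sym (act-∑ (H (entry (a ∷ γ) zero (p zero) (q zero))) (dominating s γ) _ w))
        (act-cong (H (entry (a ∷ γ) zero (p zero) (q zero)))
          (chain-geometric s γ (p ∘ suc) (q ∘ suc)) w)))

  -- The series H 0 + H 1 X + H 2 X^2 + ....
  generating : ∣V∣
  generating s = coeff (H (+ s))

  module _ {n} (α : Vec ℤ n) where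

    constants : Matrix n n
    constants i j = const (entry α i (toℕ j) (toℕ i))

    geometrics : Matrix (suc n) (suc n)
    geometrics i j = geometric (entry (α ∷ʳ 0ℤ) i (toℕ j) (toℕ i))

    -- The result of the column operations. The last column has no right neighbour to subtract and
    -- stays geometric.
    bordered : Matrix (suc n) (suc n)
    bordered i j with view j
    ... | ‵fromℕ     = geometrics i (fromℕ n)
    ... | ‵inject₁ j = const (entry (α ∷ʳ 0ℤ) i (toℕ j) (toℕ i))

    bordered-fromℕ : ∀ i → bordered i (fromℕ n) ≡ geometrics i (fromℕ n)
    bordered-fromℕ i rewrite view-fromℕ n = ≡.refl

    bordered-inject₁ : ∀ i j → bordered i (inject₁ j) ≡ const (entry (α ∷ʳ 0ℤ) i (toℕ j) (toℕ i))
    bordered-inject₁ i j rewrite view-inject₁ j = ≡.refl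

    -- One column to the right the subscript is one higher, and splitting off the first term of the
    -- series costs one factor X; hence every exponent is 1.
    geometrics-suffix : ∀ i → Suffix (λ _ → 1) (bordered i) (geometrics i)
    geometrics-suffix i .Suffix.step j
      rewrite bordered-inject₁ i j | Fin.toℕ-inject₁ j
            | entry-sucᵖ (α ∷ʳ 0ℤ) i (toℕ j) (toℕ i)
      = geometric-step _
    geometrics-suffix i .Suffix.final f rewrite bordered-fromℕ i = λ s w → refl

    bordered-last : ∀ j f s w → (bordered (fromℕ n) (inject₁ j) ⟪ f ⟫) s w ≈ 0#
    bordered-last j f s w
      rewrite bordered-inject₁ (fromℕ n) j | lookup-∷ʳ-fromℕ α 0ℤ | Fin.toℕ-fromℕ n
      = H-vanishes (Fin.toℕ<n j) w

    -- The subscript 0 + n - n is zero, so the corner entry sends 1 to the full generating series.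
    bordered-corner : ∀ s w → (bordered (fromℕ n) (fromℕ n) ⟪ δ⁰ ⟫) s w ≈ generating s w
    bordered-corner s w
      rewrite bordered-fromℕ (fromℕ n) | lookup-∷ʳ-fromℕ α 0ℤ | ℤ.+-inverseʳ (+ toℕ (fromℕ n))
      = geometric-δ⁰ 0ℤ s w

    bordered-inner : ∀ i j → bordered (inject₁ i) (inject₁ j) ≡ constants i j
    bordered-inner i j
      rewrite bordered-inject₁ (inject₁ i) j | lookup-∷ʳ-inject₁ α 0ℤ i | Fin.toℕ-inject₁ i
      = ≡.refl

    det-geometrics : det geometrics δ⁰ ≈ⱽ det constants generating
    det-geometrics s w = trans (det-suffix (λ _ → 1) geometrics-suffix δ⁰ s w)
      (trans (det-last-row bordered δ⁰ generating bordered-last bordered-corner s w)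
        (det-congˡ _ constants
          (λ i j f s w → reflexive (cong (λ o → (o ⟪ f ⟫) s w) (bordered-inner i j))) generating s w))

    -- Both sides are coefficients of X^s in `det-geometrics`. The Leibniz formula turns `constants`
    -- into 𝔖 α acting on H s, and `geometrics` into a double sum over permutations and over β,
    -- whose order is then exchanged.
    pieri-coeff : ∀ s w →
      coeff (𝔖 α ⊛ H (+ s)) w ≈ coeff (Σᴺ (dominating s (α ∷ʳ 0ℤ)) 𝔖) w
    pieri-coeff s w = begin
      coeff (𝔖 α ⊛ H (+ s)) w
        ≈⟨ coeff-⊛ (𝔖 α) (H (+ s)) w ⟩
      act (𝔖 α) (generating s) w
        ≈⟨ act-𝔖 α (generating s) w ⟩
      ∑ (permutations n) (λ σ → signed (inversions σ) (act (term α σ) (generating s) w))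
        ≈⟨ ∑-cong (permutations n) (λ σ → signed-cong (inversions σ)
             (chain-const (λ i → entry α i (toℕ (σ ⟨$⟩ʳ i)) (toℕ i)) generating s w)) ⟨
      ∑ (permutations n) (λ σ → signed (inversions σ)
        (chain (λ i → constants i (σ ⟨$⟩ʳ i)) generating s w))
        ≈⟨ det-at constants generating s w ⟨
      det constants generating s w
        ≈⟨ det-geometrics s w ⟨
      det geometrics δ⁰ s w
        ≈⟨ det-at geometrics δ⁰ s w ⟩
      ∑ (permutations (suc n)) (λ σ → signed (inversions σ)
        (chain (λ i → geometrics i (σ ⟨$⟩ʳ i)) δ⁰ s w))
        ≈⟨ ∑-cong (permutations (suc n)) (λ σ → signed-cong (inversions σ)
             (chain-geometric s (α ∷ʳ 0ℤ) (λ i → toℕ (σ ⟨$⟩ʳ i)) toℕ w)) ⟨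
      ∑ (permutations (suc n)) (λ σ → signed (inversions σ) (∑ βs (λ β → act (term β σ) δ w)))
        ≈⟨ ∑-cong (permutations (suc n)) (λ σ → ∑-additive (signed-additive (inversions σ)) βs _) ⟩
      ∑ (permutations (suc n)) (λ σ → ∑ βs (λ β → signed (inversions σ) (act (term β σ) δ w)))
        ≈⟨ ∑-swap (permutations (suc n)) βs _ ⟩
      ∑ βs (λ β → ∑ (permutations (suc n)) (λ σ → signed (inversions σ) (act (term β σ) δ w)))
        ≈⟨ ∑-cong βs (λ β → act-𝔖 β δ w) ⟨
      ∑ βs (λ β → act (𝔖 β) δ w)
        ≈⟨ act-Σ βs 𝔖 δ w ⟨
      act (Σᴺ βs 𝔖) δ w
        ≈⟨ coeff-act (Σᴺ βs 𝔖) w ⟨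
      coeff (Σᴺ βs 𝔖) w ∎
      where
      open Relation.Binary.Reasoning.Setoid setoid
      βs : List (Vec ℤ (suc n))
      βs = dominating s (α ∷ʳ 0ℤ)

-- The product formula for every integer s

proposition3p8 : ∀ {c ℓ} (𝐤 : CommutativeRing c ℓ) (n : ℕ) (α : Vec ℤ n) (s : ℤ) →
    let open NSym 𝐤 in
    𝔖 α * H s
    ≈Σ[ (λ (β : Vec ℤ (suc n)) →
    size β ≡ size α ℤ.+ s
    × (∀ (i : Fin n) → lookup α i ≤ lookup β (inject₁ i))
    × 0ℤ ≤ lookup β (fromℕ n)) ]
    𝔖
proposition3p8 𝐤 n α (+ s) =
  dominating s (α ∷ʳ 0ℤ) , dominating-unique s (α ∷ʳ 0ℤ) , (λ β → mk⇔ sound complete) ,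
  Series.pieri-coeff 𝐤 α s
  where
  sound : ∀ {β} → β ∈ dominating s (α ∷ʳ 0ℤ) →
          size β ≡ size α ℤ.+ + s × (∀ i → lookup α i ≤ lookup β (inject₁ i)) × 0ℤ ≤ lookup β (fromℕ n)
  sound {β} β∈ with dominating-sound s (α ∷ʳ 0ℤ) β∈
  ... | size≡ , α≼β =
    ≡.trans size≡ (cong (ℤ._+ + s) (size-∷ʳ-0 α)) , ≼-∷ʳ⁻ α 0ℤ β α≼β

  complete : ∀ {β} → size β ≡ size α ℤ.+ + s ×
             (∀ i → lookup α i ≤ lookup β (inject₁ i)) × 0ℤ ≤ lookup β (fromℕ n) →
             β ∈ dominating s (α ∷ʳ 0ℤ)
  complete {β} (size≡ , α≼β , 0≤) with dominating-∷ʳ-complete α β size≡ α≼β 0≤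
  ... | _ , ≡.refl , β∈ = β∈
-- For negative s both sides are zero: H s is 0, and any admissible β would have size at least that
-- of α.
proposition3p8 𝐤 n α s@(-[1+ _ ]) =
  [] , [] , (λ β → mk⇔ (λ ()) (λ P → ⊥-elim (empty {β} P))) ,
  λ w → trans (coeff-⊛ (𝔖 α) (H s) w) (act-0 (𝔖 α) w)
  where
  open CommutativeRing 𝐤 using (trans)
  open Words 𝐤

  empty : ∀ {β} → size β ≡ size α ℤ.+ s ×
          (∀ i → lookup α i ≤ lookup β (inject₁ i)) × 0ℤ ≤ lookup β (fromℕ n) → ⊥
  empty {β} (size≡ , α≼β , 0≤) with dominating-∷ʳ-complete α β size≡ α≼β 0≤
  ... | _ , () , _
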